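{- Let $n\ge3$, $r=\lceil n/2\rceil$, $P=2^r+2^{n-r+1}-3$, and let $g<Q$ be positive integers. If $\tilde D$ is any $g$-colored distribution of $QP$ pebbles on the vertices of the cycle $C_n$, then $\tilde D$ is $Q$-coverable.
   Context: A $g$-colored distribution is a placement of pebbles on the vertices of a graph in which each pebble is assigned one of $g$ colors. A color-respecting pebbling step removes two pebbles of the same color from a vertex and places one pebble of that color on an adjacent vertex. A colored distribution is $Q$-coverable if some sequence of color-respecting pebbling steps results in every vertex having at least $Q$ pebbles (of any colors). -}

module Defs where

open import Data.Nat using (ℕ; zero; suc; _+_; _*_; _∸_; _^_; _≤_; _%_; NonZero)
open import Data.Fin using (Fin; toℕ)
import Data.Fin as F
open import Data.Product using (Σ; ∃; _×_; _,_)
open import Data.Sum using (_⊎_)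
open import Relation.Binary.PropositionalEquality using (_≡_)
open import Relation.Binary.Construct.Closure.ReflexiveTransitive using (Star)
open import Relation.Nullary using (yes; no)

sumFin : ∀ k → (Fin k → ℕ) → ℕ
sumFin zero    f = 0
sumFin (suc k) f = f F.zero + sumFin k (λ i → f (F.suc i))

CycleAdj : ∀ n → .{{_ : NonZero n}} → Fin n → Fin n → Set
CycleAdj n v w = (toℕ w ≡ suc (toℕ v) % n) ⊎ (toℕ v ≡ suc (toℕ w) % n)

-- A g-colored distribution on n vertices: D v c = number of pebbles of color c on vertex v.
ColDist : ℕ → ℕ → Set
ColDist n g = Fin n → Fin g → ℕ

pebblesAt : ∀ {n g} → ColDist n g → Fin n → ℕ
pebblesAt {g = g} D v = sumFin g (D v)

size : ∀ {n g} → ColDist n g → ℕ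
size {n} D = sumFin n (pebblesAt D)

modify : ∀ {n g} → Fin n → Fin g → (ℕ → ℕ) → ColDist n g → ColDist n g
modify u c f D v d with v F.≟ u | d F.≟ c
... | yes _ | yes _ = f (D v d)
... | _     | _     = D v d

applyStep : ∀ {n g} → Fin n → Fin n → Fin g → ColDist n g → ColDist n g
applyStep v w c D = modify w c suc (modify v c (λ k → k ∸ 2) D)

data Step (n g : ℕ) .{{_ : NonZero n}} : ColDist n g → ColDist n g → Set where
  step : ∀ (D : ColDist n g) (v w : Fin n) (c : Fin g) →
         CycleAdj n v w → 2 ≤ D v c →
         Step n g D (applyStep v w c D)

Reachable : ∀ n g → .{{_ : NonZero n}} → ColDist n g → ColDist n g → Set
Reachable n g = Star (Step n g)

Coverable : ∀ n g → .{{_ : NonZero n}} → ℕ → ColDist n g → Set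
Coverable n g Q D = ∃ λ D' → Reachable n g D D' × (∀ v → Q ≤ pebblesAt D' v)

{-# OPTIONS --safe #-}
-- Since g < Q, a vertex with at least Q pebbles carries two of one color, so
-- colors can be forgotten as long as only vertices with at least Q pebbles are
-- emptied.  Write p(u) for the number of pebbles on u.  Keep a nonempty set A
-- of vertices, at first all of them, and consider
--   Σ_{u ∈ A} p(u) + Σ_{u ∉ A} min(p(u), Q) · 2^dist(u, A),
-- at first QP; it never decreases below.  While some vertex has fewer than Q
-- pebbles, take such a t closest to A, at distance d, and f ∈ A nearest to t.
-- If p(f) ≥ Q + 2^d, send one pebble from f to t: the inner vertices of the
-- path have at least Q pebbles, and the sum is preserved.  Otherwise remove f
-- from A: this loses at most p(f) − Q ≤ 2^d − 1, while for each j < d the weight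
-- of the j-th vertex from f to t rises by at least 2^j.  If A = {f}, then the
-- second case contradicts the sum being at least QP = Q Σ_u 2^dist(u, f).
module Submission where

open import Defs
open import Data.Bool using (Bool; true; false; _∧_; not; if_then_else_)
open import Data.Bool.Properties using (∧-identityʳ)
import Data.Bool as Bool
open import Data.Empty using (⊥-elim)
open import Data.Fin using (Fin; toℕ; fromℕ<)
import Data.Fin as F
open import Data.Fin.Properties using (toℕ<n; toℕ-injective; toℕ-fromℕ<; any?)
open import Data.Nat
open import Data.Nat.DivMod
open import Data.Nat.GeneralisedArithmetic using (fold; fold-+)
open import Data.Nat.Induction using (<-wellFounded)
open import Data.Nat.Properties
open import Data.Nat.Tactic.RingSolver using (solve-∀)
open import Data.Product using (∃; _×_; _,_; proj₁; proj₂)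
open import Data.Sum using (_⊎_; inj₁; inj₂; swap)
open import Function using (_∘_; id)
open import Induction.WellFounded using (Acc; acc)
open import Relation.Binary.Construct.Closure.ReflexiveTransitive using (ε; _◅_; _◅◅_)
open import Relation.Binary.PropositionalEquality
open import Relation.Nullary using (¬_; Dec; yes; no; does; contradiction)
open import Relation.Nullary.Decidable using (dec-true; _⊎-dec_)

-- Sums over vertices and along walks.

sumFin-mono : ∀ n {f h : Fin n → ℕ} → (∀ u → f u ≤ h u) → sumFin n f ≤ sumFin n h
sumFin-mono zero    f≤h = z≤n
sumFin-mono (suc n) f≤h = +-mono-≤ (f≤h F.zero) (sumFin-mono n (f≤h ∘ F.suc))

sumFin-cong : ∀ n {f h : Fin n → ℕ} → (∀ u → f u ≡ h u) → sumFin n f ≡ sumFin n h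
sumFin-cong n f≡h = ≤-antisym (sumFin-mono n (≤-reflexive ∘ f≡h))
                              (sumFin-mono n (≤-reflexive ∘ sym ∘ f≡h))

interchange : ∀ a b c d → (a + b) + (c + d) ≡ (a + c) + (b + d)
interchange = solve-∀

sumFin-+ : ∀ n (f h : Fin n → ℕ) → sumFin n (λ u → f u + h u) ≡ sumFin n f + sumFin n h
sumFin-+ zero    f h = refl
sumFin-+ (suc n) f h = trans (cong (f F.zero + h F.zero +_) (sumFin-+ n (f ∘ F.suc) (h ∘ F.suc)))
  (interchange (f F.zero) (h F.zero) _ _)

sumFin-* : ∀ n k (f : Fin n → ℕ) → sumFin n (λ u → k * f u) ≡ k * sumFin n f
sumFin-* zero    k f = sym (*-zeroʳ k)
sumFin-* (suc n) k f = trans (cong (k * f F.zero +_) (sumFin-* n k (f ∘ F.suc)))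
  (sym (*-distribˡ-+ k (f F.zero) _))

sumFin-0 : ∀ n → sumFin n (λ _ → 0) ≡ 0
sumFin-0 zero    = refl
sumFin-0 (suc n) = sumFin-0 n

single : ∀ {n} → Fin n → ℕ → Fin n → ℕ
single v k u = if does (u F.≟ v) then k else 0

single-≡ : ∀ {n} {u v : Fin n} {k} → u ≡ v → single v k u ≡ k
single-≡ {u = u} {v} u≡v rewrite dec-true (u F.≟ v) u≡v = refl

single-+ : ∀ {n} (v : Fin n) k l u → single v (k + l) u ≡ single v k u + single v l u
single-+ v k l u with does (u F.≟ v)
... | true  = refl
... | false = refl

single-0 : ∀ {n} (v u : Fin n) → single v 0 u ≡ 0
single-0 v u with does (u F.≟ v)
... | true  = refl
... | false = refl

sumFin-single : ∀ {n} (v : Fin n) k → sumFin n (single v k) ≡ k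
sumFin-single {suc n} F.zero    k = trans (cong (k +_) (sumFin-0 n)) (+-identityʳ k)
sumFin-single {suc n} (F.suc v) k =
  sumFin-single v k

sumTo : ℕ → (ℕ → ℕ) → ℕ
sumTo zero    w = 0
sumTo (suc m) w = sumTo m w + w m

-- A vertex that the walk visits several times collects all its weights, so totals never require `y`
-- to be injective.
along : ∀ {n} → ℕ → (ℕ → Fin n) → (ℕ → ℕ) → Fin n → ℕ
along m y w u = sumTo m (λ k → single (y k) (w k) u)

sumFin-along : ∀ {n} m (y : ℕ → Fin n) w → sumFin n (along m y w) ≡ sumTo m w
sumFin-along {n} zero    y w = sumFin-0 n
sumFin-along {n} (suc m) y w = trans (sumFin-+ n (along m y w) (single (y m) (w m)))
  (cong₂ _+_ (sumFin-along m y w) (sumFin-single (y m) (w m)))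

along-≥ : ∀ {n} m (y : ℕ → Fin n) w {k} → k < m → w k ≤ along m y w (y k)
along-≥ (suc m) y w {k} k<1+m with m≤n⇒m<n∨m≡n (s≤s⁻¹ k<1+m)
... | inj₁ k<m  = ≤-trans (along-≥ m y w k<m) (m≤m+n _ _)
... | inj₂ refl = ≤-trans (≤-reflexive (sym (single-≡ {u = y m} {k = w m} refl))) (m≤n+m _ _)

sumTo-mono : ∀ m {w w′ : ℕ → ℕ} → (∀ k → w k ≤ w′ k) → sumTo m w ≤ sumTo m w′
sumTo-mono zero    w≤w′ = z≤n
sumTo-mono (suc m) w≤w′ = +-mono-≤ (sumTo-mono m w≤w′) (w≤w′ m)

sumTo-split : ∀ a b w → sumTo (b + a) w ≡ sumTo a w + sumTo b (λ k → w (k + a))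
sumTo-split a zero    w = sym (+-identityʳ _)
sumTo-split a (suc b) w = trans (cong (_+ w (b + a)) (sumTo-split a b w)) (+-assoc (sumTo a w) _ _)

-- Sums of powers of two around a cycle.

double : ∀ a → a + a ≡ 2 * a
double = solve-∀

sumTo-2^ : ∀ m → sumTo m (2 ^_) + 1 ≡ 2 ^ m
sumTo-2^ zero    = refl
sumTo-2^ (suc m) = trans (rearrange (sumTo m (2 ^_)) (2 ^ m))
  (trans (cong (_+ 2 ^ m) (sumTo-2^ m)) (double (2 ^ m)))
  where
  rearrange : ∀ a b → a + b + 1 ≡ a + 1 + b
  rearrange = solve-∀

-- The second summand is what remains of `2 ^ (s + 1)`; each step of the induction splits off half
-- of it as the next term.
sumTo-2^-down : ∀ s i → i ≤ s → sumTo i (λ k → 2 ^ (s ∸ k)) + 2 ^ (s ∸ i + 1) ≡ 2 ^ (s + 1)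
sumTo-2^-down s zero    i≤s = refl
sumTo-2^-down s (suc i) i<s = begin
  sumTo i w + 2 ^ (s ∸ i) + 2 ^ (s ∸ suc i + 1) ≡⟨ cong (λ e → sumTo i w + 2 ^ (s ∸ i) + 2 ^ e) e≡ ⟩
  sumTo i w + 2 ^ (s ∸ i) + 2 ^ (s ∸ i)         ≡⟨ +-assoc (sumTo i w) _ _ ⟩
  sumTo i w + (2 ^ (s ∸ i) + 2 ^ (s ∸ i))       ≡⟨ cong (sumTo i w +_) (double (2 ^ (s ∸ i))) ⟩
  sumTo i w + 2 ^ suc (s ∸ i)                   ≡⟨ cong (λ e → sumTo i w + 2 ^ e) (+-comm 1 (s ∸ i)) ⟩
  sumTo i w + 2 ^ (s ∸ i + 1)                   ≡⟨ sumTo-2^-down s i (<⇒≤ i<s) ⟩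
  2 ^ (s + 1)                                   ∎
  where
  open ≡-Reasoning
  w : ℕ → ℕ
  w k = 2 ^ (s ∸ k)
  e≡ : s ∸ suc i + 1 ≡ s ∸ i
  e≡ = trans (+-comm (s ∸ suc i) 1) (sym (+-∸-assoc 1 i<s))

-- The `P` of the theorem: the cost of bringing one pebble to every vertex from a single stack, at
-- `2 ^ k` pebbles for distance `k`.
stackCost : ℕ → ℕ
stackCost n = 2 ^ ⌈ n /2⌉ + 2 ^ (n ∸ ⌈ n /2⌉ + 1) ∸ 3

-- Positions below `r` are bounded by the distance `k` one way round, the other `s` by the distance
-- the other way. The two geometric series are `2 ^ r - 1` and `2 ^ (s + 1) - 2`, whence the `3`.
sumTo-cycle : ∀ n → sumTo n (λ k → 2 ^ (k ⊓ (n ∸ k))) ≤ stackCost n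
sumTo-cycle n = begin
  sumTo n w                                          ≡⟨ cong (λ m → sumTo m w) (sym (⌊n/2⌋+⌈n/2⌉≡n n)) ⟩
  sumTo (s + r) w                                    ≡⟨ sumTo-split r s w ⟩
  sumTo r w + sumTo s (λ k → w (k + r))              ≤⟨ +-mono-≤ (sumTo-mono r λ k → ^-monoʳ-≤ 2 (m⊓n≤m k _))
                                                                 (sumTo-mono s λ k → ^-monoʳ-≤ 2 (far k)) ⟩
  sumTo r (2 ^_) + sumTo s (λ k → 2 ^ (s ∸ k))       ≡⟨ m+n∸n≡m _ 3 ⟨
  sumTo r (2 ^_) + sumTo s (λ k → 2 ^ (s ∸ k)) + 3 ∸ 3 ≡⟨ cong (_∸ 3) total ⟩
  stackCost n                                        ∎
  where
  open ≤-Reasoning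
  r s : ℕ
  r = ⌈ n /2⌉
  s = ⌊ n /2⌋
  w : ℕ → ℕ
  w k = 2 ^ (k ⊓ (n ∸ k))
  n∸r≡s : n ∸ r ≡ s
  n∸r≡s = trans (cong (_∸ r) (sym (⌊n/2⌋+⌈n/2⌉≡n n))) (m+n∸n≡m s r)
  far : ∀ k → (k + r) ⊓ (n ∸ (k + r)) ≤ s ∸ k
  far k = ≤-trans (m⊓n≤n (k + r) _) (≤-reflexive (trans (cong (n ∸_) (+-comm k r))
    (trans (sym (∸-+-assoc n r k)) (cong (_∸ k) n∸r≡s))))
  rearrange : ∀ a b → a + b + 3 ≡ (a + 1) + (b + 2)
  rearrange = solve-∀
  total : sumTo r (2 ^_) + sumTo s (λ k → 2 ^ (s ∸ k)) + 3 ≡ 2 ^ r + 2 ^ (n ∸ r + 1)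
  total = trans (rearrange (sumTo r (2 ^_)) _) (cong₂ _+_ (sumTo-2^ r)
    (trans (cong (λ e → sumTo s (λ k → 2 ^ (s ∸ k)) + 2 ^ (e + 1)) (sym (n∸n≡0 s)))
    (trans (sumTo-2^-down s s ≤-refl) (cong (λ e → 2 ^ (e + 1)) (sym n∸r≡s)))))

-- Pigeonhole for colors, and finite searches.

exceeds⇒pair : ∀ g (h : Fin g → ℕ) → g < sumFin g h → ∃ λ c → 2 ≤ h c
exceeds⇒pair zero    h ()
exceeds⇒pair (suc g) h g<Σ with 2 ≤? h F.zero
... | yes 2≤h = F.zero , 2≤h
... | no  2≰h = let c , 2≤hc = exceeds⇒pair g (h ∘ F.suc) rest in F.suc c , 2≤hc
  where
  rest : g < sumFin g (h ∘ F.suc)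
  rest = s≤s⁻¹ (≤-trans g<Σ (+-monoˡ-≤ _ (s≤s⁻¹ (≰⇒> 2≰h))))

argmin : ∀ {n} {P : Fin n → Set} → (∀ u → Dec (P u)) → (h : Fin n → ℕ) →
         (∀ u → ¬ P u) ⊎ ∃ λ t → P t × (∀ u → P u → h t ≤ h u)
argmin {zero}  P? h = inj₁ λ ()
argmin {suc n} P? h with P? F.zero | argmin (P? ∘ F.suc) (h ∘ F.suc)
... | no ¬P0 | inj₁ ¬P = inj₁ λ where
  F.zero    → ¬P0
  (F.suc u) → ¬P u
... | yes P0 | inj₁ ¬P = inj₂ (F.zero , P0 , λ where
  F.zero    _  → ≤-refl
  (F.suc u) Pu → contradiction Pu (¬P u))
... | no ¬P0 | inj₂ (t , Pt , min) = inj₂ (F.suc t , Pt , λ where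
  F.zero    P0 → contradiction P0 ¬P0
  (F.suc u) Pu → min u Pu)
... | yes P0 | inj₂ (t , Pt , min) with h F.zero ≤? h (F.suc t)
...   | yes h0≤ht = inj₂ (F.zero , P0 , λ where
  F.zero    _  → ≤-refl
  (F.suc u) Pu → ≤-trans h0≤ht (min u Pu))
...   | no  h0≰ht = inj₂ (F.suc t , Pt , λ where
  F.zero    _  → <⇒≤ (≰⇒> h0≰ht)
  (F.suc u) Pu → min u Pu)

-- The value `m` stands for a failed search, so `least-holds` needs `least P? m < m`.
least : {P : ℕ → Set} → (∀ k → Dec (P k)) → ℕ → ℕ
least P? zero    = 0
least P? (suc m) = if does (P? 0) then 0 else suc (least (P? ∘ suc) m)

least-bounded : ∀ {P : ℕ → Set} (P? : ∀ k → Dec (P k)) m → least P? m ≤ m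
least-bounded P? zero = z≤n
least-bounded P? (suc m) with P? 0
... | yes _ = z≤n
... | no  _ = s≤s (least-bounded (P? ∘ suc) m)

least-lower : ∀ {P : ℕ → Set} (P? : ∀ k → Dec (P k)) m {k} → P k → least P? m ≤ k
least-lower P? zero Pk = z≤n
least-lower P? (suc m) {k} Pk with P? 0
... | yes _ = z≤n
least-lower P? (suc m) {zero}  Pk | no ¬P0 = contradiction Pk ¬P0
least-lower P? (suc m) {suc k} Pk | no ¬P0 = s≤s (least-lower (P? ∘ suc) m Pk)

least-holds : ∀ {P : ℕ → Set} (P? : ∀ k → Dec (P k)) m → least P? m < m → P (least P? m)
least-holds P? (suc m) l<m with P? 0
... | yes P0 = P0
... | no  _  = least-holds (P? ∘ suc) m (s≤s⁻¹ l<m)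

-- Pebbling steps with colors forgotten.

private variable n g : ℕ

modify-suc : (D : ColDist n g) (w : Fin n) (c : Fin g) → ∀ u d →
  modify w c suc D u d ≡ D u d + single w (single c 1 d) u
modify-suc D w c u d with u F.≟ w | d F.≟ c
... | yes _ | yes _ = +-comm 1 _
... | yes _ | no _  = sym (+-identityʳ _)
... | no _  | yes _ = sym (+-identityʳ _)
... | no _  | no _  = sym (+-identityʳ _)

modify-∸2 : (D : ColDist n g) (v : Fin n) (c : Fin g) → 2 ≤ D v c → ∀ u d →
  modify v c (_∸ 2) D u d + single v (single c 2 d) u ≡ D u d
modify-∸2 D v c 2≤ u d with u F.≟ v | d F.≟ c
... | yes refl | yes refl = m∸n+n≡m 2≤
... | yes _    | no _     = +-identityʳ _
... | no _     | yes _    = +-identityʳ _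
... | no _     | no _     = +-identityʳ _

-- The net effect of a sequence of steps on the pebble counts. The loss is added on the left side,
-- which avoids truncated subtraction.
Moved : ColDist n g → ColDist n g → Fin n → Fin n → ℕ → ℕ → Set
Moved D D′ v w k l = ∀ u → pebblesAt D′ u + single v k u ≡ pebblesAt D u + single w l u

sumFin-single-single : ∀ (v : Fin n) (c : Fin g) k u →
  sumFin g (λ d → single v (single c k d) u) ≡ single v k u
sumFin-single-single {g = g} v c k u with does (u F.≟ v)
... | true  = sumFin-single c k
... | false = sumFin-0 g

swap-last : ∀ a b c → a + b + c ≡ a + c + b
swap-last = solve-∀

applyStep-moved : (D : ColDist n g) (v w : Fin n) (c : Fin g) → 2 ≤ D v c →
  Moved D (applyStep v w c D) v w 2 1
applyStep-moved {g = g} D v w c 2≤ u = begin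
  sumFin g (applyStep v w c D u) + single v 2 u  ≡⟨ cong (sumFin g (applyStep v w c D u) +_) (sumFin-single-single v c 2 u) ⟨
  sumFin g (applyStep v w c D u) + sumFin g out  ≡⟨ sumFin-+ g (applyStep v w c D u) out ⟨
  sumFin g (λ d → applyStep v w c D u d + out d) ≡⟨ sumFin-cong g pointwise ⟩
  sumFin g (λ d → D u d + inn d)                 ≡⟨ sumFin-+ g (D u) inn ⟩
  sumFin g (D u) + sumFin g inn                  ≡⟨ cong (sumFin g (D u) +_) (sumFin-single-single w c 1 u) ⟩
  sumFin g (D u) + single w 1 u                  ∎
  where
  open ≡-Reasoning
  out inn : Fin _ → ℕ
  out d = single v (single c 2 d) u
  inn d = single w (single c 1 d) u
  pointwise : ∀ d → applyStep v w c D u d + out d ≡ D u d + inn d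
  pointwise d = trans (cong (_+ out d) (modify-suc (modify v c (_∸ 2) D) w c u d))
    (trans (swap-last (modify v c (_∸ 2) D u d) (inn d) (out d))
           (cong (_+ inn d) (modify-∸2 D v c 2≤ u d)))

moved-trans : ∀ (D D′ D″ : ColDist n g) {v w x k l m} →
  Moved D D′ v w k l → Moved D′ D″ w x l m → Moved D D″ v x k m
moved-trans D D′ D″ {v} {w} {x} {k} {l} {m} M M′ u =
  +-cancelʳ-≡ (single w l u) _ _ (begin
    p″ + single v k u + single w l u ≡⟨ swap-last p″ _ _ ⟩
    p″ + single w l u + single v k u ≡⟨ cong (_+ single v k u) (M′ u) ⟩
    p′ + single x m u + single v k u ≡⟨ swap-last p′ _ _ ⟩
    p′ + single v k u + single x m u ≡⟨ cong (_+ single x m u) (M u) ⟩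
    p + single w l u + single x m u  ≡⟨ swap-last p _ _ ⟩
    p + single x m u + single w l u  ∎)
  where
  open ≡-Reasoning
  p p′ p″ : ℕ
  p  = pebblesAt D u
  p′ = pebblesAt D′ u
  p″ = pebblesAt D″ u

moved-+ : ∀ (D D′ D″ : ColDist n g) {v w k l k′ l′} →
  Moved D D′ v w k l → Moved D′ D″ v w k′ l′ → Moved D D″ v w (k + k′) (l + l′)
moved-+ D D′ D″ {v} {w} {k} {l} {k′} {l′} M M′ u = begin
  p″ + single v (k + k′) u              ≡⟨ cong (p″ +_) (trans (single-+ v k k′ u) (+-comm (single v k u) _)) ⟩
  p″ + (single v k′ u + single v k u)   ≡⟨ +-assoc p″ _ _ ⟨
  p″ + single v k′ u + single v k u     ≡⟨ cong (_+ single v k u) (M′ u) ⟩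
  p′ + single w l′ u + single v k u     ≡⟨ swap-last p′ _ _ ⟩
  p′ + single v k u + single w l′ u     ≡⟨ cong (_+ single w l′ u) (M u) ⟩
  p + single w l u + single w l′ u      ≡⟨ +-assoc p _ _ ⟩
  p + (single w l u + single w l′ u)    ≡⟨ cong (p +_) (single-+ w l l′ u) ⟨
  p + single w (l + l′) u               ∎
  where
  open ≡-Reasoning
  p p′ p″ : ℕ
  p  = pebblesAt D u
  p′ = pebblesAt D′ u
  p″ = pebblesAt D″ u

-- Only `v` loses pebbles, and it can spare `k`. The arrivals stay in the bound because `deliver`
-- spends them on the next edge.
moved-keeps : ∀ (D D′ : ColDist n g) {v w k l Q} → Moved D D′ v w k l →
  Q + k ≤ pebblesAt D v → ∀ u → Q ≤ pebblesAt D u → Q + single w l u ≤ pebblesAt D′ u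
moved-keeps D D′ {v} {w} {k} {l} {Q} M Q+k≤ u Q≤ = +-cancelʳ-≤ (single v k u) _ _ (begin
  Q + single w l u + single v k u ≡⟨ swap-last Q _ _ ⟩
  Q + single v k u + single w l u ≤⟨ +-monoˡ-≤ _ source ⟩
  pebblesAt D u + single w l u    ≡⟨ M u ⟨
  pebblesAt D′ u + single v k u   ∎)
  where
  open ≤-Reasoning
  source : Q + single v k u ≤ pebblesAt D u
  source with u F.≟ v
  ... | yes refl = Q+k≤
  ... | no _     = ≤-trans (≤-reflexive (+-identityʳ Q)) Q≤

-- Distances on the cycle.

module Distance (n : ℕ) .{{_ : NonZero n}} where

  -- Going back is going `pred n` steps forward, so both inverse laws follow from `fwd^n`.
  fwd bwd : Fin n → Fin n
  fwd v = fromℕ< (m%n<n (suc (toℕ v)) n)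
  bwd v = fold v fwd (pred n)

  toℕ-fwd^ : ∀ v k → toℕ (fold v fwd k) ≡ (toℕ v + k) % n
  toℕ-fwd^ v zero    = sym (trans (cong (_% n) (+-identityʳ (toℕ v))) (m<n⇒m%n≡m (toℕ<n v)))
  toℕ-fwd^ v (suc k) = begin
    toℕ (fwd (fold v fwd k))          ≡⟨ toℕ-fromℕ< _ ⟩
    (1 + toℕ (fold v fwd k)) % n      ≡⟨ cong (λ x → suc x % n) (toℕ-fwd^ v k) ⟩
    (1 + (toℕ v + k) % n) % n         ≡⟨ %-distribˡ-+ 1 _ n ⟩
    (1 % n + (toℕ v + k) % n % n) % n ≡⟨ cong (λ x → (1 % n + x) % n) (m%n%n≡m%n (toℕ v + k) n) ⟩
    (1 % n + (toℕ v + k) % n) % n     ≡⟨ %-distribˡ-+ 1 (toℕ v + k) n ⟨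
    (1 + (toℕ v + k)) % n             ≡⟨ cong (_% n) (+-suc (toℕ v) k) ⟨
    (toℕ v + suc k) % n               ∎
    where open ≡-Reasoning

  fwd^n : ∀ v → fold v fwd n ≡ v
  fwd^n v = toℕ-injective (trans (toℕ-fwd^ v n)
    (trans ([m+n]%n≡m%n (toℕ v) n) (m<n⇒m%n≡m (toℕ<n v))))

  fwd-bwd : ∀ v → fwd (bwd v) ≡ v
  fwd-bwd v = trans (cong (fold v fwd) (suc-pred n)) (fwd^n v)

  bwd-fwd : ∀ v → bwd (fwd v) ≡ v
  bwd-fwd v = trans (sym (fold-+ v fwd (pred n) {1}))
    (trans (cong (fold v fwd) (trans (+-comm (pred n) 1) (suc-pred n))) (fwd^n v))

  fwd-transitive : ∀ v w → ∃ λ k → k < n × fold v fwd k ≡ w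
  fwd-transitive v w = k , m%n<n _ n , toℕ-injective (begin
    toℕ (fold v fwd k)      ≡⟨ toℕ-fwd^ v k ⟩
    (a + k) % n             ≡⟨ %-distribˡ-+ a k n ⟩
    (a % n + k % n) % n     ≡⟨ cong (λ x → (a % n + x) % n) (m%n%n≡m%n (b + (n ∸ a)) n) ⟩
    (a % n + k) % n         ≡⟨ %-distribˡ-+ a (b + (n ∸ a)) n ⟨
    (a + (b + (n ∸ a))) % n ≡⟨ cong (_% n) total ⟩
    (b + n) % n             ≡⟨ [m+n]%n≡m%n b n ⟩
    b % n                   ≡⟨ m<n⇒m%n≡m (toℕ<n w) ⟩
    b                       ∎)
    where
    open ≡-Reasoning
    a b k : ℕ
    a = toℕ v
    b = toℕ w
    -- This is `b - a` modulo `n`; adding `n ∸ a` instead of subtracting `a` keeps it exact in `ℕ`.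
    k = (b + (n ∸ a)) % n
    rotate : ∀ a b c → a + (b + c) ≡ b + (c + a)
    rotate = solve-∀
    total : a + (b + (n ∸ a)) ≡ b + n
    total = trans (rotate a b (n ∸ a)) (cong (b +_) (m∸n+n≡m (<⇒≤ (toℕ<n v))))

  -- A cycle offers just two directions, so for nonempty `A` the least such `k` is the distance from
  -- `u` to `A`.
  Hit : (Fin n → Bool) → Fin n → ℕ → Set
  Hit A u k = A (fold u fwd k) ≡ true ⊎ A (fold u bwd k) ≡ true

  hit? : ∀ A u k → Dec (Hit A u k)
  hit? A u k = (A (fold u fwd k) Bool.≟ true) ⊎-dec (A (fold u bwd k) Bool.≟ true)

  -- The value is n when A is empty.
  dist : (Fin n → Bool) → Fin n → ℕ
  dist A u = least (hit? A u) n

  dist-≤ : ∀ A u {k} → Hit A u k → dist A u ≤ k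
  dist-≤ A u = least-lower (hit? A u) n

  dist-anti : ∀ A B → (∀ u → B u ≡ true → A u ≡ true) → ∀ u → dist A u ≤ dist B u
  dist-anti A B B⊆A u with dist B u <? n
  -- Here `dist B u` is the default value `n`, which bounds every `dist`.
  ... | no  ≮n = ≤-trans (least-bounded (hit? A u) n) (≮⇒≥ ≮n)
  ... | yes <n with least-holds (hit? B u) n <n
  ...   | inj₁ h = dist-≤ A u (inj₁ (B⊆A _ h))
  ...   | inj₂ h = dist-≤ A u (inj₂ (B⊆A _ h))

  -- The forward walk from `u` meets `a` in fewer than `n` steps, so the search does not end at its
  -- default value.
  dist-hit : ∀ A {a} → A a ≡ true → ∀ u → Hit A u (dist A u)
  dist-hit A {a} Aa u = let k , k<n , eq = fwd-transitive u a in
    least-holds (hit? A u) n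
      (≤-trans (s≤s (dist-≤ A u (inj₁ (trans (cong A eq) Aa)))) k<n)

  -- Lets the path from `f` to `t` be treated once for both directions: `Hit` is symmetric in them,
  -- so it can be read in terms of `next` and `prev`.
  record Orientation : Set where
    field
      next prev : Fin n → Fin n
      adjacent  : ∀ v → CycleAdj n v (next v)
      prev-next : ∀ v → prev (next v) ≡ v
      toHit     : ∀ A u k → A (fold u next k) ≡ true ⊎ A (fold u prev k) ≡ true → Hit A u k
      fromHit   : ∀ A u k → Hit A u k → A (fold u next k) ≡ true ⊎ A (fold u prev k) ≡ true

  clockwise anticlockwise : Orientation
  clockwise = record
    { next = fwd ; prev = bwd ; adjacent = λ v → inj₁ (toℕ-fromℕ< _)
    ; prev-next = bwd-fwd ; toHit = λ _ _ _ → id ; fromHit = λ _ _ _ → id }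
  anticlockwise = record
    { next = bwd ; prev = fwd
    ; adjacent = λ v → inj₂ (trans (cong toℕ (sym (fwd-bwd v))) (toℕ-fromℕ< _))
    ; prev-next = fwd-bwd ; toHit = λ _ _ _ → swap ; fromHit = λ _ _ _ → swap }

  fold-undo : ∀ (s s′ : Fin n → Fin n) → (∀ v → s′ (s v) ≡ v) →
              ∀ k v → fold (fold v s k) s′ k ≡ v
  fold-undo s s′ inv zero    v = refl
  fold-undo s s′ inv (suc k) v = begin
    s′ (fold (s (fold v s k)) s′ k) ≡⟨ cong (λ x → s′ (fold x s′ k)) shift ⟩
    s′ (fold (fold (s v) s k) s′ k) ≡⟨ cong s′ (fold-undo s s′ inv k (s v)) ⟩
    s′ (s v)                        ≡⟨ inv v ⟩
    v                               ∎
    where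
    open ≡-Reasoning
    shift : s (fold v s k) ≡ fold (s v) s k
    shift = trans (cong (fold v s) (+-comm 1 k)) (fold-+ v s k)

  -- How distances grow when a vertex is removed.

  remove : (Fin n → Bool) → Fin n → Fin n → Bool
  remove A f u = A u ∧ not (does (u F.≟ f))

  remove-∈ : ∀ A f u → remove A f u ≡ true → A u ≡ true × u ≢ f
  remove-∈ A f u r with A u | u F.≟ f
  ... | true  | no u≢f = refl , u≢f
  remove-∈ A f u () | true  | yes _
  remove-∈ A f u () | false | _

  remove-≢ : ∀ A f u → u ≢ f → remove A f u ≡ A u
  remove-≢ A f u u≢f with A u | u F.≟ f
  ... | true  | no _  = refl
  ... | true  | yes e = contradiction e u≢f
  ... | false | _     = refl

  nearest : ∀ A {a} → A a ≡ true → ∀ t → ∃ λ (o : Orientation) → let open Orientation o in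
            ∃ λ f → A f ≡ true × fold f next (dist A t) ≡ t
  nearest A Aa t with dist-hit A Aa t
  -- Walking forward from `t` leads to `f`, so the way from `f` back to `t` is anticlockwise; the
  -- other case is the mirror image.
  ... | inj₁ h = anticlockwise , _ , h , fold-undo fwd bwd bwd-fwd (dist A t) t
  ... | inj₂ h = clockwise     , _ , h , fold-undo bwd fwd fwd-bwd (dist A t) t

  dist-≤-ahead : ∀ A o {f} → A f ≡ true → ∀ k → dist A (fold f (Orientation.next o) k) ≤ k
  dist-≤-ahead A o {f} Af k = dist-≤ A _ (toHit A _ k (inj₂ (trans (cong A (fold-undo next prev prev-next k f)) Af)))
    where open Orientation o

  -- The vertices strictly within dist A t of t lie outside A, so around the
  -- j-th vertex on the way from f to t the ball of radius j meets A only in f.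
  module _ (A : Fin n → Bool) (o : Orientation) (f t : Fin n)
           (f⇝t : fold f (Orientation.next o) (dist A t) ≡ t) where
    open Orientation o

    private
      d : ℕ
      d = dist A t
      A∖f : Fin n → Bool
      A∖f = remove A f

    ahead-∉ : ∀ i → i < d + d → ¬ (A∖f (fold f next i) ≡ true)
    ahead-∉ zero    _    h = proj₂ (remove-∈ A f f h) refl
    -- Up to position `d` the vertex lies `d ∸ i` steps behind `t`, beyond that `i ∸ d` steps past
    -- it. Both numbers are less than `d`, so `A` cannot contain it.
    ahead-∉ i@(suc i′) i<2d h with remove-∈ A f _ h | i ≤? d
    ... | Ai , _ | yes i≤d = <⇒≱ (∸-monoʳ-< z<s i≤d) (dist-≤ A t (toHit A t (d ∸ i) (inj₂ (trans (cong A back) Ai))))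
      where
      back : fold t prev (d ∸ i) ≡ fold f next i
      back = trans (cong (λ x → fold x prev (d ∸ i))
        (trans (sym f⇝t) (trans (cong (fold f next) (sym (m∸n+n≡m i≤d))) (fold-+ f next (d ∸ i)))))
        (fold-undo next prev prev-next (d ∸ i) _)
    ... | Ai , _ | no i≰d = <⇒≱ i∸d<d (dist-≤ A t (toHit A t (i ∸ d) (inj₁ (trans (cong A on) Ai))))
      where
      d≤i : d ≤ i
      d≤i = <⇒≤ (≰⇒> i≰d)
      i∸d<d : i ∸ d < d
      i∸d<d = +-cancelʳ-< d _ _ (subst (_< d + d) (sym (m∸n+n≡m d≤i)) i<2d)
      on : fold t next (i ∸ d) ≡ fold f next i
      on = trans (cong (λ x → fold x next (i ∸ d)) (sym f⇝t))
        (trans (sym (fold-+ f next (i ∸ d))) (cong (fold f next) (m∸n+n≡m d≤i)))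

    dist-remove-ahead : ∀ j → j < d → j < dist A∖f (fold f next j)
    dist-remove-ahead j j<d with j <? dist A∖f (fold f next j)
    ... | yes j<d′ = j<d′
    ... | no  j≮d′ = ⊥-elim (absurd (fromHit A∖f u k (least-holds (hit? A∖f u) n k<n)))
      where
      u : Fin n
      u = fold f next j
      k : ℕ
      k = dist A∖f u
      k≤j : k ≤ j
      k≤j = ≮⇒≥ j≮d′
      -- Since `k ≤ j < d ≤ n`, the value `k` is not the default and belongs to a real hit.
      k<n : k < n
      k<n = ≤-trans (s≤s k≤j) (≤-trans j<d (least-bounded (hit? A t) n))
      behind : fold u prev k ≡ fold f next (j ∸ k)
      behind = trans (cong (λ x → fold x prev k)
        (trans (cong (fold f next) (sym (m+[n∸m]≡n k≤j))) (fold-+ f next k)))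
        (fold-undo next prev prev-next k _)
      absurd : ¬ (A∖f (fold u next k) ≡ true ⊎ A∖f (fold u prev k) ≡ true)
      absurd (inj₁ h) = ahead-∉ (k + j) (+-mono-<-≤ (≤-trans (s≤s k≤j) j<d) (<⇒≤ j<d))
        (trans (cong A∖f (fold-+ f next k)) h)
      absurd (inj₂ h) = ahead-∉ (j ∸ k) (≤-trans (s≤s (m∸n≤m j k)) (≤-trans j<d (m≤m+n d d)))
        (trans (cong A∖f (sym behind)) h)

    module _ (Af : A f ≡ true) where

      gain : ℕ → Fin n → ℕ
      gain m = along m (fold f next) (2 ^_)

      -- The maximum makes the induction work even if the walk revisits a vertex: in position `m`
      -- the distance is at most `m`, so the bound so far is `2 ^ m`, and the new `2 ^ m` doubles
      -- it.
      gain-≤ : ∀ m u → gain m u + 2 ^ dist A u ≤ 2 ^ dist A u ⊔ 2 ^ m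
      gain-≤ zero    u = m≤m⊔n _ _
      gain-≤ (suc m) u with u F.≟ fold f next m
      ... | no _ = ≤-trans (+-monoˡ-≤ _ (≤-reflexive (+-identityʳ (gain m u))))
        (≤-trans (gain-≤ m u) (⊔-monoʳ-≤ (2 ^ dist A u) (^-monoʳ-≤ 2 (n≤1+n m))))
      ... | yes refl = begin
        gain m u + 2 ^ m + 2 ^ dist A u ≡⟨ swap-last (gain m u) _ _ ⟩
        gain m u + 2 ^ dist A u + 2 ^ m ≤⟨ +-monoˡ-≤ _ (gain-≤ m u) ⟩
        2 ^ dist A u ⊔ 2 ^ m + 2 ^ m    ≡⟨ cong (_+ 2 ^ m) (m≤n⇒m⊔n≡n (^-monoʳ-≤ 2 (dist-≤-ahead A o Af m))) ⟩
        2 ^ m + 2 ^ m                   ≡⟨ double (2 ^ m) ⟩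
        2 ^ suc m                       ≤⟨ m≤n⊔m (2 ^ dist A u) _ ⟩
        2 ^ dist A u ⊔ 2 ^ suc m        ∎
        where open ≤-Reasoning

      -- If `u` is the vertex in position `m`, then `gain-≤` bounds the left side by `2 ^ suc m`,
      -- and the distance to `remove A f` exceeds `m` by `dist-remove-ahead`.
      gain-remove : ∀ m → m ≤ d → ∀ u → gain m u + 2 ^ dist A u ≤ 2 ^ dist A∖f u
      gain-remove zero    m≤d u = ^-monoʳ-≤ 2 (dist-anti A A∖f (λ v → proj₁ ∘ remove-∈ A f v) u)
      gain-remove (suc m) m<d u with u F.≟ fold f next m
      ... | no _ = ≤-trans (+-monoˡ-≤ _ (≤-reflexive (+-identityʳ (gain m u)))) (gain-remove m (<⇒≤ m<d) u)
      ... | yes refl = begin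
        gain m u + 2 ^ m + 2 ^ dist A u ≡⟨ swap-last (gain m u) _ _ ⟩
        gain m u + 2 ^ dist A u + 2 ^ m ≤⟨ +-monoˡ-≤ _ (gain-≤ m u) ⟩
        2 ^ dist A u ⊔ 2 ^ m + 2 ^ m    ≡⟨ cong (_+ 2 ^ m) (m≤n⇒m⊔n≡n (^-monoʳ-≤ 2 (dist-≤-ahead A o Af m))) ⟩
        2 ^ m + 2 ^ m                   ≡⟨ double (2 ^ m) ⟩
        2 ^ suc m                       ≤⟨ ^-monoʳ-≤ 2 (dist-remove-ahead m m<d) ⟩
        2 ^ dist A∖f u                  ∎
        where open ≤-Reasoning

  -- Going round from `f`, the vertex in position `k` is `k` steps from `f` one way and `n ∸ k` the
  -- other. Further members of `A` can only shorten distances.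
  sum-2^dist : ∀ A {f} → A f ≡ true → sumFin n (λ u → 2 ^ dist A u) ≤ stackCost n
  sum-2^dist A {f} Af = begin
    sumFin n (λ u → 2 ^ dist A u)           ≤⟨ sumFin-mono n pointwise ⟩
    sumFin n (along n (fold f fwd) w)       ≡⟨ sumFin-along n (fold f fwd) w ⟩
    sumTo n w                               ≤⟨ sumTo-cycle n ⟩
    stackCost n                             ∎
    where
    open ≤-Reasoning
    w : ℕ → ℕ
    w k = 2 ^ (k ⊓ (n ∸ k))
    pointwise : ∀ u → 2 ^ dist A u ≤ along n (fold f fwd) w u
    pointwise u with fwd-transitive f u
    ... | k , k<n , refl = ≤-trans (^-monoʳ-≤ 2 (⊓-glb (dist-≤-ahead A clockwise Af k)
            (dist-≤ A _ (inj₁ (trans (cong A around) Af))))) (along-≥ n (fold f fwd) w k<n)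
      where
      around : fold (fold f fwd k) fwd (n ∸ k) ≡ f
      around = trans (sym (fold-+ f fwd (n ∸ k)))
        (trans (cong (fold f fwd) (m∸n+n≡m (<⇒≤ k<n))) (fwd^n f))

-- Moving pebbles along the cycle.

module Cycle (n g Q : ℕ) .{{_ : NonZero n}} (g<Q : g < Q) where

  -- Before each step `v` holds at least `Q`, hence more than `g`, pebbles, so `exceeds⇒pair` finds
  -- a color to move.
  hop : ∀ m (D : ColDist n g) v w → CycleAdj n v w → Q + 2 * m ≤ pebblesAt D v →
        ∃ λ D′ → Reachable n g D D′ × Moved D D′ v w (2 * m) m
  hop zero    D v w vw enough = D , ε , λ u → cong (_ +_) (trans (single-0 v u) (sym (single-0 w u)))
  hop (suc m) D v w vw enough =
    let c , 2≤    = exceeds⇒pair g (D v) (≤-trans g<Q (≤-trans (m≤m+n Q _) enough))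
        D₁        = applyStep v w c D
        M₁        = applyStep-moved D v w c 2≤
        enough′   = ≤-trans (≤-reflexive (regroup Q m)) enough
        D₂ , R , M = hop m D₁ v w vw (≤-trans (m≤m+n _ _)
                       (moved-keeps D D₁ M₁ enough′ v (≤-trans (m≤m+n _ 2) enough′)))
    in D₂ , step D v w c vw 2≤ ◅ R ,
       subst (λ k → Moved D D₂ v w k (suc m)) (sym (*-suc 2 m)) (moved-+ D D₁ D₂ M₁ M)
    where
    regroup : ∀ q m → q + 2 * m + 2 ≡ q + 2 * suc m
    regroup = solve-∀

  -- The amount in transit halves on every edge. Since `y 1` already holds `Q` pebbles, whatever
  -- arrives there is surplus and can be sent on.
  deliver : ∀ d (D : ColDist n g) (y : ℕ → Fin n) → (∀ i → CycleAdj n (y i) (y (suc i))) →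
    (∀ i → i ≤ d → Q ≤ pebblesAt D (y i)) → Q + 2 ^ suc d ≤ pebblesAt D (y 0) →
    ∃ λ D′ → Reachable n g D D′ × Moved D D′ (y 0) (y (suc d)) (2 ^ suc d) 1
  deliver zero    D y adj full enough = hop 1 D (y 0) (y 1) (adj 0) enough
  deliver (suc d) D y adj full enough =
    let D₁ , R₁ , M₁ = hop (2 ^ suc d) D (y 0) (y 1) (adj 0) enough
        kept         = moved-keeps D D₁ M₁ enough
        D₂ , R₂ , M₂ = deliver d D₁ (y ∘ suc) (adj ∘ suc)
                         (λ i i≤d → ≤-trans (m≤m+n Q _) (kept (y (suc i)) (full (suc i) (s≤s i≤d))))
                         (≤-trans (≤-reflexive (cong (Q +_) (sym (single-≡ {u = y 1} refl))))
                                  (kept (y 1) (full 1 (s≤s z≤n))))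
    in D₂ , R₁ ◅◅ R₂ , moved-trans D D₁ D₂ M₁ M₂

  open Distance n

  -- The last component makes a delivery lower the total number of pebbles; it holds because `f` is
  -- not its own target.
  send : ∀ d (D : ColDist n g) o f → let open Orientation o in
    (∀ i → i < d → Q ≤ pebblesAt D (fold f next i)) → fold f next d ≢ f → Q + 2 ^ d ≤ pebblesAt D f →
    ∃ λ D′ → Reachable n g D D′ × Moved D D′ f (fold f next d) (2 ^ d) 1 × 2 ≤ 2 ^ d
  send zero    D o f full f≢ enough = contradiction refl f≢
  send (suc d) D o f full f≢ enough =
    let D′ , R , M = deliver d D (fold f next) (λ i → adjacent (fold f next i)) (λ i i≤d → full i (s≤s i≤d)) enough
    in D′ , R , M , *-monoʳ-≤ 2 (m^n>0 2 d)
    where open Orientation o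

  -- The potential and its behavior under removals and deliveries.

  Config : Set
  Config = Fin n → ℕ

  -- A vertex outside `A` is never again the source of a delivery, so its surplus over `Q` is
  -- dropped.
  counted : (Fin n → Bool) → Config → Config
  counted A p u = if A u then p u else p u ⊓ Q

  potential : (Fin n → Bool) → Config → ℕ
  potential A p = sumFin n (λ u → counted A p u * 2 ^ dist A u)

  counted-≥ : ∀ A p u → Q ≤ p u → Q ≤ counted A p u
  counted-≥ A p u Q≤ with A u
  ... | true  = Q≤
  ... | false = ⊓-glb Q≤ ≤-refl

  counted-∈ : ∀ A p {u} → A u ≡ true → counted A p u ≡ p u
  counted-∈ A p Au rewrite Au = refl

  counted-∉ : ∀ A p {u} → A u ≡ false → counted A p u ≡ p u ⊓ Q
  counted-∉ A p Au rewrite Au = refl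

  dist-∈ : ∀ A {u} → A u ≡ true → 2 ^ dist A u ≡ 1
  dist-∈ A {u} Au = cong (2 ^_) (n≤0⇒n≡0 (dist-≤ A u (inj₁ Au)))

  module Nearest (A : Fin n → Bool) (p : Config) (t : Fin n) (thin : p t < Q)
                 (closest : ∀ u → p u < Q → dist A t ≤ dist A u)
                 (o : Orientation) (f : Fin n) (Af : A f ≡ true)
                 (f⇝t : fold f (Orientation.next o) (dist A t) ≡ t) where
    open Orientation o
    open ≤-Reasoning

    d : ℕ
    d = dist A t

    A∖f : Fin n → Bool
    A∖f = remove A f

    -- A vertex with fewer than `Q` pebbles here would be closer to `A` than `t`.
    path-full : ∀ i → i < d → Q ≤ p (fold f next i)
    path-full i i<d = ≮⇒≥ λ p<Q → <⇒≱ i<d (≤-trans (closest _ p<Q) (dist-≤-ahead A o Af i))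

    gain-d : Config
    gain-d = gain A o f t f⇝t Af d

    -- `truncate` changes the counting at `f` under the old distances, `spread` then changes the
    -- distances. The loss `p f ∸ Q` is paid for by the total gain `sumTo d (2 ^_)`, which is
    -- `2 ^ d - 1`.
    potential-remove : p f < Q + 2 ^ d → potential A p ≤ potential A∖f p
    potential-remove pf< = +-cancelʳ-≤ (sumTo d (2 ^_)) _ _ (begin
      potential A p + sumTo d (2 ^_)                 ≡⟨ cong (potential A p +_) (sumFin-along d (fold f next) (2 ^_)) ⟨
      potential A p + sumFin n gain-d                ≡⟨ sumFin-+ n (λ u → counted A p u * 2 ^ dist A u) gain-d ⟨
      sumFin n (λ u → counted A p u * 2 ^ dist A u + gain-d u) ≤⟨ sumFin-mono n pointwise ⟩
      sumFin n (λ u → counted A∖f p u * 2 ^ dist A∖f u + single f (p f ∸ Q) u)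
                                                     ≡⟨ sumFin-+ n (λ u → counted A∖f p u * 2 ^ dist A∖f u) (single f (p f ∸ Q)) ⟩
      potential A∖f p + sumFin n (single f (p f ∸ Q)) ≡⟨ cong (potential A∖f p +_) (sumFin-single f (p f ∸ Q)) ⟩
      potential A∖f p + (p f ∸ Q)                    ≤⟨ +-monoʳ-≤ (potential A∖f p) excess ⟩
      potential A∖f p + sumTo d (2 ^_)               ∎)
      where
      excess : p f ∸ Q ≤ sumTo d (2 ^_)
      excess = begin
        p f ∸ Q                        ≤⟨ ∸-monoˡ-≤ Q (s≤s⁻¹ (≤-trans pf< (≤-reflexive (trans (cong (Q +_) (sym (sumTo-2^ d))) (regroup Q _))))) ⟩
        Q + sumTo d (2 ^_) ∸ Q         ≡⟨ m+n∸m≡n Q _ ⟩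
        sumTo d (2 ^_)                 ∎
        where
        regroup : ∀ a b → a + (b + 1) ≡ suc (a + b)
        regroup = solve-∀

      truncate : ∀ u → counted A p u * 2 ^ dist A u ≤ counted A∖f p u * 2 ^ dist A u + single f (p f ∸ Q) u
      truncate u with u F.≟ f
      ... | no _ = ≤-trans (≤-reflexive (cong (λ b → (if b then p u else p u ⊓ Q) * 2 ^ dist A u)
              (sym (∧-identityʳ (A u))))) (m≤m+n _ 0)
      ... | yes refl rewrite dist-∈ A Af | Af | *-identityʳ (p f) | *-identityʳ (p f ⊓ Q) | ⊓-comm (p f) Q =
              ≤-reflexive (sym (m⊓n+n∸m≡n Q (p f)))

      -- A vertex with `Q` pebbles has a count of at least 1, so its term grows by at least
      -- `gain-d u`. A vertex with fewer is at distance at least `d` from `A`, and `gain-≤` then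
      -- forces `gain-d u` to be zero.
      spread : ∀ u → counted A∖f p u * 2 ^ dist A u + gain-d u ≤ counted A∖f p u * 2 ^ dist A∖f u
      spread u with p u <? Q
      ... | no p≮Q = begin
        c * 2 ^ dist A u + gain-d u     ≤⟨ +-monoʳ-≤ (c * 2 ^ dist A u) (m≤n*m (gain-d u) c {{>-nonZero 0<c}}) ⟩
        c * 2 ^ dist A u + c * gain-d u ≡⟨ +-comm (c * 2 ^ dist A u) _ ⟩
        c * gain-d u + c * 2 ^ dist A u ≡⟨ *-distribˡ-+ c (gain-d u) _ ⟨
        c * (gain-d u + 2 ^ dist A u)   ≤⟨ *-monoʳ-≤ c (gain-remove A o f t f⇝t Af d ≤-refl u) ⟩
        c * 2 ^ dist A∖f u              ∎
        where
        c : ℕ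
        c = counted A∖f p u
        0<c : 0 < c
        0<c = ≤-trans (≤-trans (s≤s z≤n) g<Q) (counted-≥ A∖f p u (≮⇒≥ p≮Q))
      ... | yes p<Q = begin
        c * 2 ^ dist A u + gain-d u     ≡⟨ cong (c * 2 ^ dist A u +_) no-gain ⟩
        c * 2 ^ dist A u + 0            ≡⟨ +-identityʳ _ ⟩
        c * 2 ^ dist A u                ≤⟨ *-monoʳ-≤ c (m+n≤o⇒n≤o (gain-d u) (gain-remove A o f t f⇝t Af d ≤-refl u)) ⟩
        c * 2 ^ dist A∖f u              ∎
        where
        c : ℕ
        c = counted A∖f p u
        no-gain : gain-d u ≡ 0
        no-gain = n≤0⇒n≡0 (+-cancelʳ-≤ (2 ^ dist A u) _ 0 (≤-trans (gain-≤ A o f t f⇝t Af d u)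
          (≤-reflexive (m≥n⇒m⊔n≡m (^-monoʳ-≤ 2 (closest u p<Q))))))

      pointwise : ∀ u → counted A p u * 2 ^ dist A u + gain-d u
                      ≤ counted A∖f p u * 2 ^ dist A∖f u + single f (p f ∸ Q) u
      pointwise u = begin
        counted A p u * 2 ^ dist A u + gain-d u                             ≤⟨ +-monoˡ-≤ (gain-d u) (truncate u) ⟩
        counted A∖f p u * 2 ^ dist A u + single f (p f ∸ Q) u + gain-d u    ≡⟨ swap-last (counted A∖f p u * 2 ^ dist A u) _ _ ⟩
        counted A∖f p u * 2 ^ dist A u + gain-d u + single f (p f ∸ Q) u    ≤⟨ +-monoˡ-≤ _ (spread u) ⟩
        counted A∖f p u * 2 ^ dist A∖f u + single f (p f ∸ Q) u             ∎

    -- Here `f` is the only vertex of `A`. Compared with `Q` pebbles everywhere, `f` contributes at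
    -- most `p f ∸ Q < 2 ^ d` too much, while `t` lacks at least one pebble of weight `2 ^ d`.
    potential-alone : (∀ u → A∖f u ≢ true) → p f < Q + 2 ^ d → potential A p < Q * stackCost n
    potential-alone alone pf< = +-cancelʳ-< (2 ^ d) _ _ (begin-strict
      potential A p + 2 ^ d                                    ≡⟨ cong (potential A p +_) (sumFin-single t (2 ^ d)) ⟨
      potential A p + sumFin n (single t (2 ^ d))              ≡⟨ sumFin-+ n (λ u → counted A p u * 2 ^ dist A u) (single t (2 ^ d)) ⟨
      sumFin n (λ u → counted A p u * 2 ^ dist A u + single t (2 ^ d) u) ≤⟨ sumFin-mono n pointwise ⟩
      sumFin n (λ u → Q * 2 ^ dist A u + single f (p f ∸ Q) u) ≡⟨ sumFin-+ n (λ u → Q * 2 ^ dist A u) (single f (p f ∸ Q)) ⟩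
      sumFin n (λ u → Q * 2 ^ dist A u) + sumFin n (single f (p f ∸ Q))
                                                               ≡⟨ cong₂ _+_ (sumFin-* n Q (λ u → 2 ^ dist A u)) (sumFin-single f (p f ∸ Q)) ⟩
      Q * sumFin n (λ u → 2 ^ dist A u) + (p f ∸ Q)            ≤⟨ +-monoˡ-≤ _ (*-monoʳ-≤ Q (sum-2^dist A Af)) ⟩
      Q * stackCost n + (p f ∸ Q)                              <⟨ +-monoʳ-< (Q * stackCost n) (m<n+o⇒m∸n<o (p f) Q {{>-nonZero (m^n>0 2 d)}} pf<) ⟩
      Q * stackCost n + 2 ^ d                                  ∎)
      where
      outside : ∀ u → u ≢ f → A u ≡ false
      outside u u≢f with A u in Au
      ... | false = refl
      ... | true  = contradiction (trans (remove-≢ A f u u≢f) Au) (alone u)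

      pointwise : ∀ u → counted A p u * 2 ^ dist A u + single t (2 ^ d) u ≤ Q * 2 ^ dist A u + single f (p f ∸ Q) u
      pointwise u with u F.≟ f | u F.≟ t
      -- The vertex `t` can be `f` itself; then the weight `2 ^ d` is 1 and `thin` gives the
      -- deficit.
      ... | yes refl | yes refl rewrite dist-∈ A Af | counted-∈ A p Af | *-identityʳ (p f) | *-identityʳ Q | +-comm (p f) 1
                                = ≤-trans thin (m≤m+n Q _)
      ... | yes refl | no _     rewrite dist-∈ A Af | counted-∈ A p Af | *-identityʳ (p f) | *-identityʳ Q | +-identityʳ (p f)
                                = m≤n+m∸n (p f) Q
      ... | no u≢f   | yes refl rewrite counted-∉ A p (outside u u≢f) | +-identityʳ (Q * 2 ^ dist A u)
                                | +-comm ((p u ⊓ Q) * 2 ^ dist A u) (2 ^ dist A u)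
                                = *-monoˡ-≤ (2 ^ dist A u) (≤-trans (s≤s (m⊓n≤m (p u) Q)) thin)
      ... | no u≢f   | no _     rewrite counted-∉ A p (outside u u≢f)
                                = +-monoˡ-≤ 0 (*-monoˡ-≤ (2 ^ dist A u) (m⊓n≤n (p u) Q))

    t≢f : Q + 2 ^ d ≤ p f → t ≢ f
    t≢f enough refl = <⇒≱ thin (≤-trans (m≤m+n Q _) enough)

    -- From `f` leave `2 ^ d` pebbles of weight 1; at `t` arrives one pebble of weight `2 ^ d`. It
    -- is fully counted, since `t` had fewer than `Q`.
    potential-deliver : ∀ p′ → Q + 2 ^ d ≤ p f → (∀ u → p′ u + single f (2 ^ d) u ≡ p u + single t 1 u) →
                        potential A p ≤ potential A p′
    potential-deliver p′ enough moved = +-cancelʳ-≤ (2 ^ d) _ _ (begin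
      potential A p + 2 ^ d                        ≡⟨ cong (potential A p +_) (sumFin-single t (2 ^ d)) ⟨
      potential A p + sumFin n (single t (2 ^ d))  ≡⟨ sumFin-+ n (λ u → counted A p u * 2 ^ dist A u) (single t (2 ^ d)) ⟨
      sumFin n (λ u → counted A p u * 2 ^ dist A u + single t (2 ^ d) u)  ≤⟨ sumFin-mono n pointwise ⟩
      sumFin n (λ u → counted A p′ u * 2 ^ dist A u + single f (2 ^ d) u) ≡⟨ sumFin-+ n (λ u → counted A p′ u * 2 ^ dist A u) (single f (2 ^ d)) ⟩
      potential A p′ + sumFin n (single f (2 ^ d)) ≡⟨ cong (potential A p′ +_) (sumFin-single f (2 ^ d)) ⟩
      potential A p′ + 2 ^ d                       ∎)
      where
      one-more : ∀ {a b} → suc a ≤ b → a < Q → ∀ c → suc (if c then a else a ⊓ Q) ≤ (if c then b else b ⊓ Q)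
      one-more a<b a<Q true  = a<b
      one-more {a} a<b a<Q false = ≤-trans (s≤s (m⊓n≤m a Q)) (⊓-glb a<b a<Q)

      pointwise : ∀ u → counted A p u * 2 ^ dist A u + single t (2 ^ d) u
                      ≤ counted A p′ u * 2 ^ dist A u + single f (2 ^ d) u
      pointwise u with u F.≟ f | u F.≟ t | moved u
      ... | yes refl | yes refl | _ = contradiction refl (t≢f enough)
      ... | yes refl | no _ | eq rewrite dist-∈ A Af | counted-∈ A p Af | counted-∈ A p′ Af
                                       | *-identityʳ (p f) | *-identityʳ (p′ f) = ≤-reflexive (sym eq)
      ... | no _ | yes refl | eq rewrite +-identityʳ (counted A p′ u * 2 ^ dist A u)
                                       | +-comm (counted A p u * 2 ^ dist A u) (2 ^ dist A u)
        = *-monoˡ-≤ (2 ^ dist A u) (one-more (≤-reflexive (sym (trans (sym (+-identityʳ (p′ u))) (trans eq (+-comm (p u) 1))))) thin (A u))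
      ... | no _ | no _ | eq = +-monoˡ-≤ 0 (*-monoˡ-≤ (2 ^ dist A u) (≤-reflexive
              (cong (λ x → if A u then x else x ⊓ Q) (sym (+-cancelʳ-≡ 0 (p′ u) (p u) eq)))))

  -- Termination and the covering argument.

  bit : Bool → ℕ
  bit b = if b then 1 else 0

  -- Termination measure: a delivery lowers the number of pebbles, a removal lowers the size of `A`.
  fuel : (Fin n → Bool) → Config → ℕ
  fuel A p = sumFin n (λ u → p u + bit (A u))

  fuel-remove : ∀ A p f → A f ≡ true → fuel (remove A f) p < fuel A p
  fuel-remove A p f Af = begin-strict
    fuel (remove A f) p                        <⟨ n<1+n _ ⟩
    1 + fuel (remove A f) p                    ≡⟨ cong (_+ fuel (remove A f) p) (sumFin-single f 1) ⟨
    sumFin n (single f 1) + fuel (remove A f) p ≡⟨ sumFin-+ n (single f 1) (λ u → p u + bit (remove A f u)) ⟨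
    sumFin n (λ u → single f 1 u + (p u + bit (remove A f u))) ≤⟨ sumFin-mono n pointwise ⟩
    fuel A p                                   ∎
    where
    open ≤-Reasoning
    pointwise : ∀ u → single f 1 u + (p u + bit (remove A f u)) ≤ p u + bit (A u)
    pointwise u with u F.≟ f
    ... | yes refl rewrite Af = ≤-reflexive (regroup (p f))
      where
      regroup : ∀ a → 1 + (a + 0) ≡ a + 1
      regroup = solve-∀
    ... | no _ with A u
    ...   | true  = ≤-refl
    ...   | false = ≤-refl

  fuel-deliver : ∀ A p p′ f t k → 2 ≤ k → (∀ u → p′ u + single f k u ≡ p u + single t 1 u) →
                 fuel A p′ < fuel A p
  fuel-deliver A p p′ f t k 2≤k moved = +-cancelʳ-< 1 _ _ (begin-strict
    fuel A p′ + 1                    <⟨ +-monoʳ-< (fuel A p′) 2≤k ⟩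
    fuel A p′ + k                    ≡⟨ cong (fuel A p′ +_) (sumFin-single f k) ⟨
    fuel A p′ + sumFin n (single f k) ≡⟨ sumFin-+ n (λ u → p′ u + bit (A u)) (single f k) ⟨
    sumFin n (λ u → p′ u + bit (A u) + single f k u) ≡⟨ sumFin-cong n (λ u → trans (swap-last (p′ u) _ _)
                                                          (trans (cong (_+ bit (A u)) (moved u)) (swap-last (p u) _ _))) ⟩
    sumFin n (λ u → p u + bit (A u) + single t 1 u) ≡⟨ sumFin-+ n (λ u → p u + bit (A u)) (single t 1) ⟩
    fuel A p + sumFin n (single t 1) ≡⟨ cong (fuel A p +_) (sumFin-single t 1) ⟩
    fuel A p + 1                     ∎)
    where open ≤-Reasoning

  cover : ∀ A (D : ColDist n g) → Acc _<_ (fuel A (pebblesAt D)) → ∀ {a} → A a ≡ true →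
          Q * stackCost n ≤ potential A (pebblesAt D) → Coverable n g Q D
  cover A D (acc rec) Aa large with argmin (λ u → pebblesAt D u <? Q) (dist A)
  ... | inj₁ none = D , ε , λ u → ≮⇒≥ (none u)
  ... | inj₂ (t , thin , closest) with nearest A Aa t
  ...   | o , f , Af , f⇝t with Q + 2 ^ dist A t ≤? pebblesAt D f
  ...     | yes enough =
    let D′ , R , M , 2≤2^d = send (dist A t) D o f path-full (t≢f enough ∘ trans (sym f⇝t)) enough
        moved            = subst (λ w → Moved D D′ f w (2 ^ dist A t) 1) f⇝t M
        D″ , R′ , full   = cover A D′ (rec (fuel-deliver A (pebblesAt D) (pebblesAt D′) f t _ 2≤2^d moved)) Aa
                             (≤-trans large (potential-deliver (pebblesAt D′) enough moved))
    in D″ , R ◅◅ R′ , full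
    where open Nearest A (pebblesAt D) t thin closest o f Af f⇝t
  ...     | no few with any? (λ b → remove A f b Bool.≟ true)
  ...       | yes (b , A∖fb) = cover (remove A f) D (rec (fuel-remove A (pebblesAt D) f Af)) A∖fb
                                 (≤-trans large (potential-remove (≰⇒> few)))
    where open Nearest A (pebblesAt D) t thin closest o f Af f⇝t
  -- Now `f` is all of `A`, and the potential would lie below `Q * stackCost n`.
  ...       | no alone = contradiction large (<⇒≱ (potential-alone (λ u h → alone (u , h)) (≰⇒> few)))
    where open Nearest A (pebblesAt D) t thin closest o f Af f⇝t

theorem3p4 : (n g Q : ℕ) → .{{_ : NonZero n}} → 3 ≤ n → 1 ≤ g → g < Q →
    (D : ColDist n g) →
    size D ≡ Q * (2 ^ ⌈ n /2⌉ + 2 ^ (n ∸ ⌈ n /2⌉ + 1) ∸ 3) →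
    Coverable n g Q D
theorem3p4 n@(suc _) g Q _ _ g<Q D size≡ =
  cover everything D (<-wellFounded _) {F.zero} refl (begin
    Q * stackCost n                    ≡⟨ size≡ ⟨
    -- All vertices lie in `everything`, so all pebbles are counted, and no weight is below 1.
    sumFin n (pebblesAt D)             ≤⟨ sumFin-mono n (λ u → m≤m*n (pebblesAt D u) (2 ^ dist everything u) {{m^n≢0 2 (dist everything u)}}) ⟩
    potential everything (pebblesAt D) ∎)
  where
  open Cycle n g Q g<Q
  open Distance n
  open ≤-Reasoning
  everything : Fin n → Bool
  everything _ = true
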